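{- Let $t,k,v,d$ be positive integers with $t<k$ and $v\ge2$, and suppose some $(d,t)$-CDA$(N;k,v)$ exists. Then $(d,t)\text{ -CDAN}(k,v)\ge (d+1)v^t$; that is, every $(d,t)$-CDA$(N;k,v)$ has $N\ge (d+1)v^t$.
   Context: Let $A=(a_{ij})$ be an $N\times k$ array with entries from a set $V$ of size $v$. A consecutive $t$-way interaction is a set $T=\{(i,x_i),\dots,(i+t-1,x_{i+t-1})\}$ with $1\le i\le k-t+1$ and all $x_r\in V$. Write $\rho(A,T)=\{r: a_{r,j}=x_j \text{ for all } (j,x_j)\in T\}$ and $\rho(A,\mathcal T)=\bigcup_{T\in\mathcal T}\rho(A,T)$. A CCA$(N;t,k,v)$ is an $N\times k$ array over $V$ in which every set of $t$ consecutive columns contains every $t$-tuple over $V$ at least once as a row. A $(d,t)$-CDA$(N;k,v)$ is a CCA$(N;t,k,v)$ $A$ such that for every set $\mathcal T$ of exactly $d$ distinct consecutive $t$-way interactions and every consecutive $t$-way interaction $T$: $\rho(A,T)\subseteq\rho(A,\mathcal T)$ iff $T\in\mathcal T$. $(d,t)$-CDAN$(k,v)$ denotes the minimum $N$ for which a $(d,t)$-CDA$(N;k,v)$ exists.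
   Formalization: The formal statement adds the hypothesis d < (k−t+1)v^t (more than d consecutive t-way interactions exist); otherwise the detecting condition is vacuous or trivial and an array with only v^t rows is a (d,t)-CDA, so the bound fails. -}

module Defs where

open import Data.Fin using (Fin; toℕ; fromℕ<)
open import Data.Fin.Properties using (toℕ<n)
open import Data.List using (List; length)
open import Data.List.Membership.Propositional using (_∈_)
open import Data.List.Relation.Unary.Unique.Propositional using (Unique)
open import Data.Nat using (ℕ; _+_; _≤_)
open import Data.Nat.Properties using (<-≤-trans; +-monoʳ-<)
open import Data.Product using (∃-syntax; Σ-syntax; _×_)
open import Data.Vec using (Vec; lookup)
open import Function.Bundles using (_⇔_)
open import Level using (0ℓ)
open import Relation.Binary.PropositionalEquality using (_≡_)
open import Relation.Unary using (Pred; _⊆_)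

Array : ℕ → ℕ → ℕ → Set
Array N k v = Fin N → Fin k → Fin v

-- Columns are numbered from 0, so a block of t consecutive columns starting
-- at i lies inside the array exactly when i + t ≤ k.
column : ∀ {t k} (i : ℕ) → i + t ≤ k → Fin t → Fin k
column i fits j = fromℕ< (<-≤-trans (+-monoʳ-< i (toℕ<n j)) fits)

-- The set {(i,x_i),…,(i+t-1,x_{i+t-1})}, presented by its first column and
-- its values. For t ≥ 1 two such sets are equal iff these data are, so _≡_
-- on this record is equality of interactions (proofs of _≤_ being unique).
record Interaction (t k v : ℕ) : Set where
  constructor interaction
  field
    start  : ℕ
    fits   : start + t ≤ k
    values : Vec (Fin v) t

open Interaction public

ρ : ∀ {N t k v} → Array N k v → Interaction t k v → Pred (Fin N) 0ℓ
ρ A T r = ∀ j → A r (column (start T) (fits T) j) ≡ lookup (values T) j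

ρ⋃ : ∀ {N t k v} → Array N k v → List (Interaction t k v) → Pred (Fin N) 0ℓ
ρ⋃ A 𝒯 r = ∃[ T ] (T ∈ 𝒯 × ρ A T r)

IsCCA : ∀ {N k v} → ℕ → Array N k v → Set
IsCCA {N} {k} {v} t A =
  ∀ i (fits : i + t ≤ k) (x : Vec (Fin v) t) →
  ∃[ r ] (∀ j → A r (column i fits j) ≡ lookup x j)

-- A set of exactly d interactions is a duplicate-free list of length d.
record IsCDA {N k v : ℕ} (d t : ℕ) (A : Array N k v) : Set where
  field
    isCCA     : IsCCA t A
    detecting : (𝒯 : List (Interaction t k v)) → Unique 𝒯 → length 𝒯 ≡ d →
                (T : Interaction t k v) → (ρ A T ⊆ ρ⋃ A 𝒯) ⇔ (T ∈ 𝒯)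

CDAExists : (d t N k v : ℕ) → Set
CDAExists d t N k v = Σ[ A ∈ Array N k v ] IsCDA d t A

-- "M is (d,t)-CDAN(k,v)". A relation rather than a function, since the
-- minimum is only defined when some array exists.
record IsCDAN (d t k v M : ℕ) : Set where
  field
    attained : CDAExists d t M k v
    minimal  : ∀ N → CDAExists d t N k v → M ≤ N

{-# OPTIONS --safe #-}
module Submission where

-- If at most d rows cover an interaction T, then each of these rows covers
-- another interaction, starting at a different column. These at most d
-- interactions, padded to exactly d interactions other than T, cover ρ(A,T)
-- without containing T, against detection. So more than d rows cover each of
-- the v^t interactions on the first t columns, and these sets of rows are
-- disjoint.

open import Defs
open import Data.Fin using (Fin; toℕ; inject≤; combine; remQuot; finToFun; funToFin)
import Data.Fin as Fin
open import Data.Fin.Properties using (_≟_; toℕ<n; toℕ-injective; inject≤-injective; injective⇒≤; ¬∀⟶∃¬; combine-remQuot; funToFin-finToFin)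
open import Data.List using (List; []; _∷_; length; lookup; map; filter; deduplicate; allFin)
open import Data.List.Properties using (length-map; length-deduplicate)
open import Data.List.Membership.Propositional using (_∈_; _∉_)
open import Data.List.Membership.Propositional.Properties using (∈-lookup; ∈-map⁺; ∈-map⁻; ∈-filter⁺; ∈-filter⁻; ∈-deduplicate⁺; ∈-deduplicate⁻; ∈-allFin)
import Data.List.Membership.DecPropositional as DecMembership
open import Data.List.Relation.Binary.Subset.Propositional using (_⊆_)
import Data.List.Relation.Unary.All as All
open import Data.List.Relation.Unary.All.Properties using (¬Any⇒All¬)
open import Data.List.Relation.Unary.Any using (here; there; index)
open import Data.List.Relation.Unary.Any.Properties using (lookup-index)
open import Data.List.Relation.Unary.AllPairs using (_∷_)
open import Data.List.Relation.Unary.Unique.Propositional using (Unique)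
open import Data.List.Relation.Unary.Unique.Propositional.Properties using (allFin⁺; filter⁺)
import Data.List.Relation.Unary.Unique.DecPropositional.Properties as DecUnique
open import Data.Nat using (ℕ; zero; suc; _+_; _*_; _∸_; _^_; _≤_; _<_; s≤s⁻¹)
open import Data.Nat.Properties as ℕ using (≤-irrelevant; ≤-trans; ≤-reflexive; <⇒≤; ≮⇒≥; ≤⇒≯; m≤n⇒m<n∨m≡n; +-monoˡ-≤; m∸n+n≡m)
open import Data.Product using (∃-syntax; _×_; _,_; proj₂; uncurry)
open import Data.Sum using (inj₁; inj₂)
open import Data.Vec as Vec using (Vec; tabulate)
open import Data.Vec.Properties using (tabulate-cong; tabulate∘lookup; lookup∘tabulate)
import Data.Vec.Properties as Vec
open import Function using (_∘_)
open import Function.Bundles using (Equivalence)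
open import Function.Definitions using (Injective)
open import Relation.Binary.Definitions using (DecidableEquality)
open import Relation.Binary.PropositionalEquality using (_≡_; _≢_; refl; sym; trans; cong; cong₂; subst)
open import Relation.Nullary using (yes; no; contradiction)
open import Relation.Nullary.Decidable using (decidable-stable)

module _ {A : Set} where

  Unique⇒lookup-injective : {xs : List A} → Unique xs → Injective _≡_ _≡_ (lookup xs)
  Unique⇒lookup-injective {_ ∷ _} (_ ∷ _) {Fin.zero} {Fin.zero} _ = refl
  Unique⇒lookup-injective {_ ∷ _} (x∉ ∷ _) {Fin.zero} {Fin.suc j} eq = contradiction eq (All.lookup x∉ (∈-lookup j))
  Unique⇒lookup-injective {_ ∷ _} (x∉ ∷ _) {Fin.suc i} {Fin.zero} eq = contradiction (sym eq) (All.lookup x∉ (∈-lookup i))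
  Unique⇒lookup-injective {_ ∷ _} (_ ∷ u) {Fin.suc i} {Fin.suc j} eq = cong Fin.suc (Unique⇒lookup-injective u eq)

  -- Pigeonhole: sending `i` to the position at which `f i` occurs in `xs` is injective, because the
  -- position determines the value.
  injective⇒≤-length : ∀ {m} {f : Fin m → A} {xs} → Injective _≡_ _≡_ f →
    (∀ i → f i ∈ xs) → m ≤ length xs
  injective⇒≤-length {xs = xs} f-inj f∈xs = injective⇒≤ λ {i} {j} eq →
    f-inj (trans (lookup-index (f∈xs i))
      (trans (cong (lookup xs) eq) (sym (lookup-index (f∈xs j)))))

module _ {A : Set} (_≟ᴬ_ : DecidableEquality A) {m} {f : Fin m → A} (f-inj : Injective _≡_ _≡_ f) where

  open DecMembership _≟ᴬ_ using (_∈?_)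

  fresh : ∀ xs → length xs < m → ∃[ y ] y ∉ xs
  fresh xs short =
    let i , fi∉xs = ¬∀⟶∃¬ m (λ i → f i ∈ xs) (λ i → f i ∈? xs)
          (λ f∈xs → ≤⇒≯ (injective⇒≤-length f-inj f∈xs) short)
    in f i , fi∉xs

  -- Induction on `d`, adding one fresh element at a time. The bound `d < m` is strict so that `x`
  -- itself can be counted among the forbidden elements.
  pad-avoiding : ∀ x {d} → d < m → ∀ {xs} → Unique xs → x ∉ xs → length xs ≤ d →
    ∃[ ys ] (Unique ys × length ys ≡ d × x ∉ ys × xs ⊆ ys)
  pad-avoiding x {zero} _ {[]} u x∉ _ = [] , u , refl , x∉ , λ z∈ → z∈
  pad-avoiding x {suc d} d<m {xs} u x∉ len with m≤n⇒m<n∨m≡n len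
  ... | inj₂ eq = xs , u , eq , x∉ , λ z∈ → z∈
  ... | inj₁ lt
    with ys , u′ , refl , x∉ys , xs⊆ys ← pad-avoiding x (<⇒≤ d<m) u x∉ (s≤s⁻¹ lt)
    -- Freshness for `x ∷ ys` keeps the longer list both duplicate-free and clear of `x`. The list
    -- `x ∷ ys` has exactly as many elements as the list being built, hence fewer than `m`.
    with y , y∉ ← fresh (x ∷ ys) d<m =
      y ∷ ys , ¬Any⇒All¬ ys (y∉ ∘ there) ∷ u′ , refl
      , (λ { (here x≡y) → y∉ (here (sym x≡y)) ; (there x∈) → x∉ys x∈ })
      , there ∘ xs⊆ys

remQuot-injective : ∀ {n} k → Injective _≡_ _≡_ (remQuot {n} k)
remQuot-injective {n} k {i} {j} eq =
  trans (sym (combine-remQuot {n} k i))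
    (trans (cong (uncurry combine) eq) (combine-remQuot {n} k j))

module _ {N : ℕ} {B : Set} (_≟ᴮ_ : DecidableEquality B) (g : Fin N → B) where

  fibre : B → List (Fin N)
  fibre b = filter (λ r → g r ≟ᴮ b) (allFin N)

  ∈-fibre⁺ : ∀ {r b} → g r ≡ b → r ∈ fibre b
  ∈-fibre⁺ {r} {b} = ∈-filter⁺ (λ r → g r ≟ᴮ b) (∈-allFin r)

  ∈-fibre⁻ : ∀ {r b} → r ∈ fibre b → g r ≡ b
  ∈-fibre⁻ {b = b} = proj₂ ∘ ∈-filter⁻ (λ r → g r ≟ᴮ b) {xs = allFin N}

  fibre-unique : ∀ b → Unique (fibre b)
  fibre-unique b = filter⁺ (λ r → g r ≟ᴮ b) (allFin⁺ N)

  -- Fibres over distinct values are disjoint, so taking the first `c` elements of each of the `m`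
  -- fibres injects `Fin (c * m)` into `Fin N`.
  large-fibres⇒≤ : ∀ {m c} {e : Fin m → B} → Injective _≡_ _≡_ e →
    (∀ j → c ≤ length (fibre (e j))) → c * m ≤ N
  large-fibres⇒≤ {m} {c} {e} e-inj large =
    injective⇒≤ {f = uncurry pick ∘ remQuot m} (remQuot-injective {c} m ∘ pick-injective)
    where
    pick : Fin c → Fin m → Fin N
    pick i j = lookup (fibre (e j)) (inject≤ i (large j))

    g-pick : ∀ i j → g (pick i j) ≡ e j
    g-pick i j = ∈-fibre⁻ (∈-lookup (inject≤ i (large j)))

    pick-injective : Injective _≡_ _≡_ (uncurry pick)
    pick-injective {i , j} {i′ , j′} eq
      -- Applying `g` to the common row recovers the fibre it came from; within a single fibre,
      -- equal rows sit at equal positions.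
      with refl ← e-inj (trans (sym (g-pick i j)) (trans (cong g eq) (g-pick i′ j′))) =
      cong (_, j) (inject≤-injective (large j) (large j) i i′
        (Unique⇒lookup-injective (fibre-unique (e j)) eq))

_≟ⱽ_ : ∀ {v t} → DecidableEquality (Vec (Fin v) t)
_≟ⱽ_ = Vec.≡-dec _≟_

_≟ᴵ_ : ∀ {t k v} → DecidableEquality (Interaction t k v)
interaction i p x ≟ᴵ interaction j q y with i ℕ.≟ j | x ≟ⱽ y
... | yes refl | yes refl = yes (cong (λ r → interaction i r x) (≤-irrelevant p q))
... | no i≢j   | _        = no (i≢j ∘ cong start)
... | yes _    | no x≢y   = no (x≢y ∘ cong values)

nthVec : ∀ {v t} → Fin (v ^ t) → Vec (Fin v) t
nthVec {v} {t} n = tabulate (finToFun {v} {t} n)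

-- Equal vectors yield only pointwise equal functions, so decoding them with `funToFin` has to
-- respect pointwise equality.
funToFin-cong : ∀ {m n} {f g : Fin m → Fin n} → (∀ i → f i ≡ g i) → funToFin f ≡ funToFin g
funToFin-cong {zero}  _   = refl
funToFin-cong {suc _} f≗g = cong₂ combine (f≗g Fin.zero) (funToFin-cong (f≗g ∘ Fin.suc))

nthVec-injective : ∀ {v t} → Injective _≡_ _≡_ (nthVec {v} {t})
nthVec-injective {v} {t} {i} {j} eq =
  trans (sym (funToFin-finToFin {t} {v} i)) (trans (funToFin-cong pointwise) (funToFin-finToFin {t} {v} j))
  where
  pointwise : ∀ l → finToFun {v} {t} i l ≡ finToFun {v} {t} j l
  pointwise l = trans (sym (lookup∘tabulate _ l))
    (trans (cong (λ x → Vec.lookup x l) eq) (lookup∘tabulate _ l))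

module _ {t k v : ℕ} (t≤k : t ≤ k) where

  -- There are `k ∸ t + 1` admissible starts and `v ^ t` value vectors for each. This enumeration
  -- supplies enough distinct interactions for padding to size `d` while avoiding one of them.
  nthInteraction : Fin ((k ∸ t + 1) * v ^ t) → Interaction t k v
  nthInteraction n with i , x ← remQuot {k ∸ t + 1} (v ^ t) n =
    interaction (toℕ i)
      -- The index gives `toℕ i ≤ k ∸ t`; adding `t` back recovers `k` because `t ≤ k`.
      (≤-trans (+-monoˡ-≤ t (s≤s⁻¹ (subst (toℕ i <_) (ℕ.+-comm (k ∸ t) 1) (toℕ<n i))))
        (≤-reflexive (m∸n+n≡m t≤k)))
      (nthVec x)

  nthInteraction-injective : Injective _≡_ _≡_ nthInteraction
  nthInteraction-injective eq = remQuot-injective {k ∸ t + 1} (v ^ t)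
    (cong₂ _,_ (toℕ-injective (cong start eq)) (nthVec-injective {v} {t} (cong values eq)))

window : ∀ {N k v t : ℕ} → Array N k v → (i : ℕ) → i + t ≤ k → Fin N → Vec (Fin v) t
window A i fits r = tabulate (A r ∘ column i fits)

module _ {N t k v : ℕ} (A : Array N k v) where

  ρ⇒window : ∀ (T : Interaction t k v) {r} → ρ A T r → window A (start T) (fits T) r ≡ values T
  ρ⇒window T covers = trans (tabulate-cong covers) (tabulate∘lookup (values T))

  ρ-window : ∀ {i} (fits : i + t ≤ k) r → ρ A (interaction i fits (window A i fits r)) r
  ρ-window fits r j = sym (lookup∘tabulate _ j)

  -- Listing ρ(A,T) as a fibre of the window map makes the row sets of interactions with a common
  -- start disjoint fibres of one map.
  rowsCovering : Interaction t k v → List (Fin N)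
  rowsCovering T = fibre _≟ⱽ_ (window A (start T) (fits T)) (values T)

  module _ {d} (t≤k : t ≤ k) (d<interactions : d < (k ∸ t + 1) * v ^ t) (cda : IsCDA d t A) where

    -- The block at `i` may overlap the columns of `T`: differing starts alone make the interactions
    -- different, whatever their values.
    d<rowsCovering : ∀ T {i} → i ≢ start T → i + t ≤ k → d < length (rowsCovering T)
    d<rowsCovering T {i} i≢start fits′ = decidable-stable (d ℕ.<? length (rowsCovering T))
      λ few → let
        𝒯 , unique , len , T∉𝒯 , others⊆𝒯 =
          pad-avoiding _≟ᴵ_ (nthInteraction-injective t≤k) T d<interactions
            -- Several rows covering `T` may agree on the block at `i`, while detection speaks of
            -- duplicate-free lists.
            (DecUnique.deduplicate-! _≟ᴵ_ others)
            (T∉others ∘ ∈-deduplicate⁻ _≟ᴵ_ others)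
            (≤-trans (length-deduplicate _≟ᴵ_ others)
              (≤-trans (≤-reflexive (length-map other (rowsCovering T))) (≮⇒≥ few)))
        -- Each row covering `T` is also covered by its own `other r`, which lies in `𝒯`; detection
        -- then forces `T` into `𝒯`.
        in T∉𝒯 (Equivalence.to (IsCDA.detecting cda 𝒯 unique len T) λ {r} covers →
          other r
          , others⊆𝒯 (∈-deduplicate⁺ _≟ᴵ_
              (∈-map⁺ other (∈-fibre⁺ _≟ⱽ_ _ (ρ⇒window T covers))))
          , ρ-window fits′ r)
      where
      other : Fin N → Interaction t k v
      other r = interaction i fits′ (window A i fits′ r)

      others : List (Interaction t k v)
      others = map other (rowsCovering T)

      T∉others : T ∉ others
      T∉others T∈ with _ , _ , T≡ ← ∈-map⁻ other T∈ = i≢start (sym (cong start T≡))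

CDA-bound : ∀ {t k v d N} → t < k → d < (k ∸ t + 1) * v ^ t →
  CDAExists d t N k v → (d + 1) * v ^ t ≤ N
CDA-bound {t} {v = v} {d} t<k d<interactions (A , cda) =
  large-fibres⇒≤ _≟ⱽ_ (window A 0 (<⇒≤ t<k)) (nthVec-injective {v} {t}) λ n →
    ≤-trans (≤-reflexive (ℕ.+-comm d 1))
      (d<rowsCovering A (<⇒≤ t<k) d<interactions cda
        -- The second start is 1: `t < k` unfolds to `1 + t ≤ k`, which is exactly the condition for
        -- that block to fit.
        (interaction 0 (<⇒≤ t<k) (nthVec n)) {1} (λ ()) t<k)

mainTheorem4 : (t k v d : ℕ) → 1 ≤ t → 1 ≤ d → t < k → 2 ≤ v →
    d < (k ∸ t + 1) * v ^ t →
    (∃[ N ] CDAExists d t N k v) →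
    (∀ M → IsCDAN d t k v M → (d + 1) * v ^ t ≤ M) ×
    (∀ N → CDAExists d t N k v → (d + 1) * v ^ t ≤ N)
mainTheorem4 t k v d _ _ t<k _ d<interactions _ =
  (λ M cdan → CDA-bound t<k d<interactions (IsCDAN.attained cdan)) ,
  (λ N → CDA-bound t<k d<interactions)
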